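{- Let $k \geq 2$, $0 \leq j \leq k-1$, and $n = a(k+1) + r \geq 0$ with integers $a$ and $r$, $-1 \leq r \leq k-1$. (i) If $r=0$, $j \geq 1$ and $a$ is odd, then $v_2(B_n(k,j)) = 1$. (ii) If $r=0$, $1 \leq j \leq k-2$, $a$ is even and $v_2(a) \leq k$, then $v_2(B_n(k,j)) = 1+ v_2(a)$. (iii) If $r=1$, $j \geq 2$, $a$ is odd and $v_2(a+1) \leq k+1$, then $v_2(B_n(k,j)) = 1+ v_2(a+1)$. (iv) If $r=1$, $j \geq 2$, $a$ is even and $v_2(a) \leq k+1$, then $v_2(B_n(k,j)) = 1+ v_2(a)$. (v) If $r=1$, $j=0$ and $a$ is odd, then $v_2(B_n(k,j)) = 1$. (vi) If $r=j+1 \leq k-1$, $j\geq 1$ and $v_2(a) \leq k$, then $v_2(B_n(k,j)) = 1 + v_2(a)$.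
   Context: For integers $k \geq 2$ and $0 \leq j \leq k-1$, the sequence $\{B_n(k,j)\}_{n\geq 0}$ is defined by the recurrence $B_n(k,j) = B_{n-1}(k,j) + B_{n-2}(k,j)+\dots+B_{n-k}(k,j)$ for all $n \geq k$, with initial values $B_j(k,j)=1$ and $B_i(k,j)=0$ for $0 \leq i \leq k-1$, $i \neq j$. $v_2$ denotes the 2-adic order (2-adic valuation), with the convention $v_2(0)=+\infty$ (so a hypothesis such as $v_2(a) \leq k$ excludes $a=0$). -}

module Defs where

open import Data.Bool.Base using (if_then_else_)
open import Data.Integer.Base using (ℤ; +_; ∣_∣)
open import Data.Integer.Divisibility using (_∣_)
open import Data.List.Base
  using (List; []; _∷_; map; take; applyUpTo; downFrom)
open import Data.Nat.Base
  using (ℕ; zero; suc; _+_; _∸_; _^_; _≤_; _<_; z≤n; s≤s)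
import Data.Nat.Divisibility as ℕ
open import Data.Nat.ListAction using (sum)
import Data.Nat.Properties as ℕ
open import Data.Product.Base using (_×_; _,_)
open import Relation.Binary.PropositionalEquality
  using (_≡_; _≢_; refl; sym; trans; cong; subst)
open import Relation.Nullary
  using (¬_; yes; no; does; contradiction)
open import Relation.Nullary.Decidable using (dec-true; dec-false)
open import Relation.Nullary.Construct.Add.Supremum
  using (_⁺; ⊤⁺; [_]) public
open import Relation.Binary.Construct.Add.Supremum.NonStrict _≤_
  using (_≤⁺_) public
import Data.Maybe.Base as Maybe

Even Odd : ℤ → Set
Even a = + 2 ∣ a
Odd a = ¬ Even a

-- history k j n lists B 0, …, B (n ∸ 1), most recent first.

nextTerm : (k j n : ℕ) → List ℕ → ℕ
nextTerm k j n h =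
  if does (n ℕ.<? k)
  then (if does (n ℕ.≟ j) then 1 else 0)
  else sum (take k h)

history : (k j n : ℕ) → List ℕ
history k j zero    = []
history k j (suc n) = nextTerm k j n (history k j n) ∷ history k j n

B : (k j n : ℕ) → ℕ
B k j n = nextTerm k j n (history k j n)

B-initial-1 : ∀ {k j} → j < k → B k j j ≡ 1
B-initial-1 {k} {j} j<k
  rewrite dec-true (j ℕ.<? k) j<k | dec-true (j ℕ.≟ j) refl = refl

B-initial-0 : ∀ {k j i} → i < k → i ≢ j → B k j i ≡ 0
B-initial-0 {k} {j} {i} i<k i≢j
  rewrite dec-true (i ℕ.<? k) i<k | dec-false (i ℕ.≟ j) i≢j = refl

history≡map-B : ∀ k j n → history k j n ≡ map (B k j) (downFrom n)
history≡map-B k j zero    = refl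
history≡map-B k j (suc n) = cong (B k j n ∷_) (history≡map-B k j n)

take-map-downFrom : ∀ (f : ℕ → ℕ) {k n} → k ≤ n →
  take k (map f (downFrom n)) ≡ applyUpTo (λ i → f (n ∸ suc i)) k
take-map-downFrom f z≤n       = refl
take-map-downFrom f {suc k} {suc n} (s≤s k≤n) =
  cong (f n ∷_) (take-map-downFrom f k≤n)

-- B n = B (n ∸ 1) + B (n ∸ 2) + … + B (n ∸ k)
B-recurrence : ∀ {k j n} → k ≤ n →
  B k j n ≡ sum (applyUpTo (λ i → B k j (n ∸ suc i)) k)
B-recurrence {k} {j} {n} k≤n
  rewrite dec-false (n ℕ.<? k) (ℕ.≤⇒≯ k≤n)
  = cong sum (trans (cong (take k) (history≡map-B k j n))
                    (take-map-downFrom (B k j) k≤n))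

ℕ∞ : Set
ℕ∞ = ℕ ⁺

infixr 6 _+∞_

_+∞_ : ℕ → ℕ∞ → ℕ∞
m +∞ x = Maybe.map (λ l → m + l) x

-- The largest e ≤ b such that 2 ^ e divides n.
largestExponent : (n b : ℕ) → ℕ
largestExponent n zero    = 0
largestExponent n (suc b) =
  if does (2 ^ suc b ℕ.∣? n) then suc b else largestExponent n b

-- Exponents up to n suffice for n > 0, as n < 2 ^ n.
v₂ℕ : ℕ → ℕ∞
v₂ℕ zero      = ⊤⁺
v₂ℕ n@(suc _) = [ largestExponent n n ]

v₂ : ℤ → ℕ∞
v₂ x = v₂ℕ ∣ x ∣

n<2^n : ∀ n → n < 2 ^ n
n<2^n zero    = s≤s z≤n
n<2^n (suc n) = ℕ.+-mono-≤ (ℕ.m^n>0 2 n)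
  (subst (suc n ≤_) (sym (ℕ.+-identityʳ (2 ^ n))) (n<2^n n))

2^-mono-∣ : ∀ {d e} → d ≤ e → 2 ^ d ℕ.∣ 2 ^ e
2^-mono-∣ {e = e} z≤n       = ℕ.1∣ (2 ^ e)
2^-mono-∣         (s≤s d≤e) = ℕ.*-monoʳ-∣ 2 (2^-mono-∣ d≤e)

largestExponent-spec : ∀ n b → ¬ (2 ^ suc b ℕ.∣ n) →
  2 ^ largestExponent n b ℕ.∣ n × ¬ (2 ^ suc (largestExponent n b) ℕ.∣ n)
largestExponent-spec n zero    ∤n = ℕ.1∣ n , ∤n
largestExponent-spec n (suc b) ∤n with 2 ^ suc b ℕ.∣? n
... | yes ∣n = ∣n , ∤n
... | no ∤n′ = largestExponent-spec n b ∤n′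

v₂ℕ-sound : ∀ n {e} → v₂ℕ n ≡ [ e ] → 2 ^ e ℕ.∣ n × ¬ (2 ^ suc e ℕ.∣ n)
v₂ℕ-sound n@(suc _) refl = largestExponent-spec n n
  (ℕ.>⇒∤ (ℕ.<-trans (ℕ.n<1+n n) (n<2^n (suc n))))

v₂ℕ-complete : ∀ n {e} → 2 ^ e ℕ.∣ n → ¬ (2 ^ suc e ℕ.∣ n) → v₂ℕ n ≡ [ e ]
v₂ℕ-complete zero      {e} _  ∤n = contradiction ((2 ^ suc e) ℕ.∣0) ∤n
v₂ℕ-complete n@(suc _) {e} ∣n ∤n
  with l∣n , l∤n ← v₂ℕ-sound n refl
  = cong [_] (ℕ.≤-antisym
      (ℕ.≮⇒≥ λ e<l → ∤n (ℕ.∣-trans (2^-mono-∣ e<l) l∣n))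
      (ℕ.≮⇒≥ λ l<e → l∤n (ℕ.∣-trans (2^-mono-∣ l<e) ∣n)))

v₂-sound : ∀ x {e} → v₂ x ≡ [ e ] →
  + (2 ^ e) ∣ x × ¬ (+ (2 ^ suc e) ∣ x)
v₂-sound x = v₂ℕ-sound ∣ x ∣

v₂-complete : ∀ x {e} → + (2 ^ e) ∣ x → ¬ (+ (2 ^ suc e) ∣ x) → v₂ x ≡ [ e ]
v₂-complete x = v₂ℕ-complete ∣ x ∣

{-# OPTIONS --safe #-}

-- Let x be the shift. It satisfies x^(k+1) = 2 x^k - 1 on sequences with the
-- recurrence, so its square is 1 + 4 (x^k + x^2k) - 8 x^k. Squaring and
-- multiplying such expansions gives, for e ≥ 1,
--   x^(2^e m (k+1)) = 1 + 2^(e+1) m (x^k + x^2k)   modulo 2^(e+2).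
-- Hence for even a and B_r = 0 the valuation of B_{a(k+1)+r} is 1 + v₂(a) as
-- soon as B_{k+r} + B_{2k+r} is odd. For odd a one extra factor 2 x^k - 1
-- shows that it is 1 as soon as B_{k+r} is odd.

module Submission where

open import Defs
open import Data.Nat.Base using (ℕ; _≤_; _≥_; _+_; _∸_)
open import Data.Integer.Base as ℤ using (ℤ; +_; 0ℤ; 1ℤ; -1ℤ)
open import Data.Product.Base using (_×_)
open import Relation.Binary.PropositionalEquality using (_≡_)

open import Data.Integer.Divisibility.Signed
  using (divides; ∣⇒∣ᵤ; ∣ᵤ⇒∣; ∣m+n∣n⇒∣m)
import Data.Integer.Properties as ℤ
open import Data.Integer.Tactic.RingSolver using (solve-∀)
open import Data.List.Base using (applyUpTo)
open import Data.Nat.Base using (zero; suc; _*_; _^_; _<_; z≤n; s≤s)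
import Data.Nat.Divisibility as ℕ
open import Data.Nat.ListAction using (sum)
import Data.Nat.Properties as ℕ
open import Data.Product.Base using (Σ-syntax; ∃-syntax; _,_; proj₁; proj₂)
open import Data.Sum.Base using (_⊎_; inj₁; inj₂)
open import Relation.Binary.PropositionalEquality
  using (_≢_; refl; sym; ≢-sym; trans; cong; cong₂; subst; subst₂;
         module ≡-Reasoning)
open import Relation.Nullary using (contradiction; yes; no)

-- Integer solutions of the telescoped recurrence.

-- The sum of k terms is replaced by its three-term consequence x^(k+1) = 2 x^k - 1. Values lie in ℤ
-- so that solutions can be subtracted and continued backwards.
record Solution (k : ℕ) : Set where
  field
    term       : ℕ → ℤ
    recurrence : ∀ m →
      term (suc (k + m)) ≡ + 2 ℤ.* term (k + m) ℤ.- term m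

open Solution

private variable
  k : ℕ

infixl 6 _⊕_
infixl 7 _·_

-- With `_·_` and `shift`, this lets integer polynomials in x act on solutions. Remainders are thus
-- solutions themselves, and an expansion can be applied to them again.
_⊕_ : Solution k → Solution k → Solution k
term (u ⊕ v) m = term u m ℤ.+ term v m
recurrence (_⊕_ {k} u v) m
  rewrite recurrence u m | recurrence v m
  = identity (term u (k + m)) (term u m) (term v (k + m)) (term v m)
  where
  identity : ∀ a b c d →
    + 2 ℤ.* a ℤ.- b ℤ.+ (+ 2 ℤ.* c ℤ.- d) ≡
    + 2 ℤ.* (a ℤ.+ c) ℤ.- (b ℤ.+ d)
  identity = solve-∀

_·_ : ℤ → Solution k → Solution k
term (c · u) m = c ℤ.* term u m
recurrence (c · u) m rewrite recurrence u m = identity c _ _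
  where
  identity : ∀ c a b →
    c ℤ.* (+ 2 ℤ.* a ℤ.- b) ≡ + 2 ℤ.* (c ℤ.* a) ℤ.- c ℤ.* b
  identity = solve-∀

shift : ℕ → Solution k → Solution k
term (shift N u) m = term u (N + m)
recurrence (shift {k} N u) m
  rewrite ℕ.+-suc N (k + m)
        | sym (ℕ.+-assoc N k m) | ℕ.+-comm N k | ℕ.+-assoc k N m
  = recurrence u (N + m)

-- The oldest term of the recurrence has coefficient -1, so it can be solved for over ℤ. Positive
-- order ensures that the other two terms already belong to `u`.
previous : Solution (suc k) → Solution (suc k)
term (previous {k} u) zero    = + 2 ℤ.* term u k ℤ.- term u (suc k)
term (previous u) (suc m) = term u m
recurrence (previous {k} u) zero
  rewrite ℕ.+-identityʳ k = identity (term u k) (term u (suc k))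
  where
  identity : ∀ a b → b ≡ + 2 ℤ.* a ℤ.- (+ 2 ℤ.* a ℤ.- b)
  identity = solve-∀
recurrence (previous {k} u) (suc m)
  rewrite ℕ.+-suc k m = recurrence u m

unshift : ∀ N (u : Solution (suc k)) →
  Σ[ v ∈ Solution (suc k) ] (∀ m → term v (N + m) ≡ term u m)
unshift zero    u = u , λ _ → refl
unshift (suc N) u with v , v≡u ← unshift N u = previous v , v≡u

-- Expansions of powers of the shift.

-- With x the shift, this is (x ^ k + x ^ 2k) u.
middle : Solution k → Solution k
middle {k} u = shift k u ⊕ shift k (shift k u)

-- x ^ N = 1 + 4 c s (x ^ k + x ^ 2k) + 8 c Q for a polynomial Q in the shift x.
Expansion : (k : ℕ) (c s : ℤ) (N : ℕ) → Set
Expansion k c s N = (u : Solution k) → Σ[ q ∈ Solution k ] (∀ r →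
  term u (N + r) ≡
  term u r ℤ.+ + 4 ℤ.* c ℤ.* s ℤ.* term (middle u) r
           ℤ.+ + 8 ℤ.* c ℤ.* term q r)

expansion-zero : ∀ c → Expansion k c 0ℤ 0
expansion-zero c u = 0ℤ · u ,
  λ r → identity c (term u r) (term (middle u) r) (term u r)
  where
  identity : ∀ c a p b →
    a ≡ a ℤ.+ + 4 ℤ.* c ℤ.* 0ℤ ℤ.* p ℤ.+ + 8 ℤ.* c ℤ.* (0ℤ ℤ.* b)
  identity = solve-∀

-- x ^ (k + 1) = 2 x ^ k - 1, squared.
expansion-base : Expansion k 1ℤ 1ℤ (2 * suc k)
expansion-base {k} u = -1ℤ · shift k u , λ r → begin
  term u (2 * suc k + r)
    ≡⟨ cong (term u) (index r) ⟩
  term u (suc (k + suc (k + r)))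
    ≡⟨ recurrence u (suc (k + r)) ⟩
  + 2 ℤ.* term u (k + suc (k + r)) ℤ.- term u (suc (k + r))
    ≡⟨ cong (λ i → + 2 ℤ.* term u i ℤ.- term u (suc (k + r)))
         (ℕ.+-suc k (k + r)) ⟩
  + 2 ℤ.* term u (suc (k + (k + r))) ℤ.- term u (suc (k + r))
    ≡⟨ cong₂ (λ y z → + 2 ℤ.* y ℤ.- z)
         (recurrence u (k + r)) (recurrence u r) ⟩
  + 2 ℤ.* (+ 2 ℤ.* term u (k + (k + r)) ℤ.- term u (k + r))
    ℤ.- (+ 2 ℤ.* term u (k + r) ℤ.- term u r)
    ≡⟨ identity (term u r) (term u (k + r)) (term u (k + (k + r))) ⟩
  _ ∎
  where
  open ≡-Reasoning
  index : ∀ r → 2 * suc k + r ≡ suc (k + suc (k + r))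
  index r rewrite ℕ.+-identityʳ k = cong suc (ℕ.+-assoc k (suc k) r)
  identity : ∀ a b c →
    + 2 ℤ.* (+ 2 ℤ.* c ℤ.- b) ℤ.- (+ 2 ℤ.* b ℤ.- a) ≡
    a ℤ.+ + 4 ℤ.* 1ℤ ℤ.* 1ℤ ℤ.* (b ℤ.+ c) ℤ.+ + 8 ℤ.* 1ℤ ℤ.* (-1ℤ ℤ.* b)
  identity = solve-∀

-- With W = x^k + x^2k, the factors 1 + 4 c s W + 8 c Q and 1 + 4 c t W + 8 c P are multiplied. The
-- coefficients of W add, and the cross term 16 c^2 s t W^2 is absorbed into the remainder.
expansion-+ : ∀ c s t {N M} → Expansion k c s N → Expansion k c t M →
  Expansion k c (s ℤ.+ t) (N + M)
expansion-+ {k} c s t {N} {M} expandN expandM u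
  with q , q-eq ← expandN u
     | p , p-eq ← expandM u
     | h , h-eq ← expandM (middle u)
  -- The remainder of the first factor stays as x^M Q; `h` comes from expanding the second factor on
  -- `middle u`.
  = shift M q ⊕ p ⊕
      (+ 2 ℤ.* c ℤ.* s ℤ.* t · middle (middle u) ⊕ + 4 ℤ.* c ℤ.* s · h)
  , λ r → begin
  term u (N + M + r)
    ≡⟨ cong (term u) (ℕ.+-assoc N M r) ⟩
  term u (N + (M + r))
    ≡⟨ q-eq (M + r) ⟩
  _
    ≡⟨ cong₂ (λ y z → y ℤ.+ + 4 ℤ.* c ℤ.* s ℤ.* z
                        ℤ.+ + 8 ℤ.* c ℤ.* term q (M + r))
         (p-eq r) (h-eq r) ⟩
  _
    ≡⟨ identity c s t (term u r) (term (middle u) r)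
         (term (middle (middle u)) r)
         (term q (M + r)) (term p r) (term h r) ⟩
  _ ∎
  where
  open ≡-Reasoning
  identity : ∀ c s t a m mm q p h →
    a ℤ.+ + 4 ℤ.* c ℤ.* t ℤ.* m ℤ.+ + 8 ℤ.* c ℤ.* p
      ℤ.+ + 4 ℤ.* c ℤ.* s ℤ.*
            (m ℤ.+ + 4 ℤ.* c ℤ.* t ℤ.* mm ℤ.+ + 8 ℤ.* c ℤ.* h)
      ℤ.+ + 8 ℤ.* c ℤ.* q
    ≡ a ℤ.+ + 4 ℤ.* c ℤ.* (s ℤ.+ t) ℤ.* m ℤ.+ + 8 ℤ.* c ℤ.*
        (q ℤ.+ p ℤ.+ (+ 2 ℤ.* c ℤ.* s ℤ.* t ℤ.* mm ℤ.+ + 4 ℤ.* c ℤ.* s ℤ.* h))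
  identity = solve-∀

-- (1 + 4 c W) ^ 2 = 1 + 8 c W + 16 c (c W ^ 2) for W = x ^ k + x ^ 2k + 2 Q.
expansion-double : ∀ c {N} → Expansion k c 1ℤ N →
  Expansion k (+ 2 ℤ.* c) 1ℤ (N + N)
expansion-double {k} c {N} expand u
  with q , q-eq ← expand u
  with h , h-eq ← expand (middle u ⊕ + 2 · q)
  = q ⊕ c · (middle (middle u ⊕ + 2 · q) ⊕ + 2 · h)
  , λ r → begin
  term u (N + N + r)
    ≡⟨ cong (term u) (ℕ.+-assoc N N r) ⟩
  term u (N + (N + r))
    ≡⟨ q-eq (N + r) ⟩
  _
    ≡⟨ regroup c (term u (N + r)) (term (middle u) (N + r))
         (term q (N + r)) ⟩
  term u (N + r) ℤ.+ + 4 ℤ.* c ℤ.*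
    (term (middle u) (N + r) ℤ.+ + 2 ℤ.* term q (N + r))
    ≡⟨ cong₂ (λ y z → y ℤ.+ + 4 ℤ.* c ℤ.* z) (q-eq r) (h-eq r) ⟩
  _
    ≡⟨ identity c (term u r) (term (middle u) r) (term q r)
         (term (middle (middle u ⊕ + 2 · q)) r) (term h r) ⟩
  _ ∎
  where
  open ≡-Reasoning
  regroup : ∀ c a m q →
    a ℤ.+ + 4 ℤ.* c ℤ.* 1ℤ ℤ.* m ℤ.+ + 8 ℤ.* c ℤ.* q ≡
    a ℤ.+ + 4 ℤ.* c ℤ.* (m ℤ.+ + 2 ℤ.* q)
  regroup = solve-∀
  identity : ∀ c a m q w h →
    a ℤ.+ + 4 ℤ.* c ℤ.* 1ℤ ℤ.* m ℤ.+ + 8 ℤ.* c ℤ.* q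
      ℤ.+ + 4 ℤ.* c ℤ.* ((m ℤ.+ + 2 ℤ.* q)
        ℤ.+ + 4 ℤ.* c ℤ.* 1ℤ ℤ.* w ℤ.+ + 8 ℤ.* c ℤ.* h)
    ≡ a ℤ.+ + 4 ℤ.* (+ 2 ℤ.* c) ℤ.* 1ℤ ℤ.* m ℤ.+ + 8 ℤ.* (+ 2 ℤ.* c) ℤ.*
        (q ℤ.+ c ℤ.* (w ℤ.+ + 2 ℤ.* h))
  identity = solve-∀

-- The precision 8 c is kept while the coefficient counts the factors, so an odd `m` leaves it odd.
expansion-* : ∀ c {N} m → Expansion k c 1ℤ N → Expansion k c (+ m) (m * N)
expansion-* c zero    expand = expansion-zero c
expansion-* c (suc m) expand =
  expansion-+ c 1ℤ (+ m) expand (expansion-* c m expand)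

-- Repeated squaring starts from the square of x^(k+1), hence the exponent e + 1 on the right
-- against c = 2^e.
expansion-2^ : ∀ e → Expansion k (+ (2 ^ e)) 1ℤ (2 ^ suc e * suc k)
expansion-2^ zero        = expansion-base
expansion-2^ {k} (suc e) = subst₂ (λ c N → Expansion k c 1ℤ N)
  (sym (ℤ.pos-* 2 (2 ^ e))) double
  (expansion-double (+ (2 ^ e)) (expansion-2^ e))
  where
  double : 2 ^ suc e * suc k + 2 ^ suc e * suc k ≡ 2 ^ suc (suc e) * suc k
  double = trans (sym (ℕ.*-distribʳ-+ (suc k) (2 ^ suc e) (2 ^ suc e)))
    (cong (λ i → (2 ^ suc e + i) * suc k) (sym (ℕ.+-identityʳ (2 ^ suc e))))

-- Parity and 2-adic valuation.

isOdd : ∀ z → Odd (1ℤ ℤ.+ + 2 ℤ.* z)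
isOdd z even with ℕ.∣1⇒≡1 (∣⇒∣ᵤ (∣m+n∣n⇒∣m {m = 1ℤ} (∣ᵤ⇒∣ even)
  (divides z (ℤ.*-comm (+ 2) z))))
... | ()

half : ∀ n → ∃[ m ] (n ≡ 2 * m ⊎ n ≡ 1 + 2 * m)
half zero = 0 , inj₁ refl
half (suc n) with half n
... | m , inj₁ refl = m , inj₂ refl
... | m , inj₂ refl = suc m , inj₁ (cong suc (sym (ℕ.+-suc m (m + 0))))

odd-ℕ : ∀ {n} → Odd (+ n) → ∃[ m ] n ≡ 1 + 2 * m
odd-ℕ {n} odd with half n
... | m , inj₁ refl = contradiction (ℕ.m∣m*n m) odd
... | m , inj₂ eq   = m , eq

v₂-2^*odd : ∀ e z → v₂ (+ (2 ^ e) ℤ.* (1ℤ ℤ.+ + 2 ℤ.* z)) ≡ [ e ]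
v₂-2^*odd e z = v₂-complete (+ (2 ^ e) ℤ.* y)
  (subst (2 ^ e ℕ.∣_) (sym abs) (ℕ.m∣m*n ℤ.∣ y ∣))
  λ d → isOdd z (ℕ.*-cancelˡ-∣ (2 ^ e) {{ℕ.m^n≢0 2 e}}
    (subst₂ ℕ._∣_ (ℕ.*-comm 2 (2 ^ e)) abs d))
  where
  y = 1ℤ ℤ.+ + 2 ℤ.* z
  abs : ℤ.∣ + (2 ^ e) ℤ.* y ∣ ≡ 2 ^ e * ℤ.∣ y ∣
  abs = ℤ.abs-* (+ (2 ^ e)) y

-- Evenness makes the exponent positive, as `expansion-2^` requires; an even cofactor would allow a
-- higher power of 2.
v₂-even : ∀ a → Even (+ suc a) →
  ∃[ e ] ∃[ m ] (suc a ≡ (1 + 2 * m) * 2 ^ suc e × v₂ (+ suc a) ≡ [ suc e ])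
v₂-even a even
  with largestExponent (suc a) (suc a) | v₂ℕ-sound (suc a) refl
... | zero  | _ , ∤a = contradiction even ∤a
... | suc e | ℕ.divides q eq , ∤a
  with m , q-odd ← odd-ℕ {q} (λ 2∣q → ∤a
         (subst (2 ^ suc (suc e) ℕ.∣_) (sym eq) (ℕ.*-monoˡ-∣ (2 ^ suc e) 2∣q)))
  = e , m , trans eq (cong (_* 2 ^ suc e) q-odd) , refl

pos-odd : ∀ m → + (1 + 2 * m) ≡ 1ℤ ℤ.+ + 2 ℤ.* + m
pos-odd m = cong (λ y → 1ℤ ℤ.+ y) (ℤ.pos-* 2 m)

-- Valuations of a solution at a (k + 1) + r.

-- For a = 2 b + 1, start at index k + 1 + r, where the value 2 u_(k+r) - u_r is twice an odd
-- number. The remaining shift by 2 b (k + 1) changes it by a multiple of 4.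
v₂-odd-multiple : (u : Solution k) → ∀ r t a → Odd (+ a) →
  term u r ≡ 0ℤ → term u (k + r) ≡ 1ℤ ℤ.+ + 2 ℤ.* t →
  v₂ (term u (a * suc k + r)) ≡ [ 1 ]
v₂-odd-multiple {k} u r t a odd u-r≡0 u-k+r≡odd
  with b , refl ← odd-ℕ {a} odd
  with q , q-eq ← expansion-* 1ℤ b expansion-base u
  = trans (cong v₂ eq) (v₂-2^*odd 1 z)
  where
  open ≡-Reasoning
  r′ = suc (k + r)
  z = t ℤ.+ + b ℤ.* term (middle u) r′ ℤ.+ + 2 ℤ.* term q r′
  index : (1 + 2 * b) * suc k + r ≡ b * (2 * suc k) + r′
  index = trans (cong (_+ r)
      (trans (ℕ.+-comm (suc k) (2 * b * suc k))
        (cong (_+ suc k) (trans (cong (_* suc k) (ℕ.*-comm 2 b))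
          (ℕ.*-assoc b 2 (suc k))))))
    (ℕ.+-assoc (b * (2 * suc k)) (suc k) r)
  identity : ∀ b t p q →
    + 2 ℤ.* (1ℤ ℤ.+ + 2 ℤ.* t) ℤ.- 0ℤ ℤ.+ + 4 ℤ.* 1ℤ ℤ.* b ℤ.* p
      ℤ.+ + 8 ℤ.* 1ℤ ℤ.* q
    ≡ + 2 ℤ.* (1ℤ ℤ.+ + 2 ℤ.* (t ℤ.+ b ℤ.* p ℤ.+ + 2 ℤ.* q))
  identity = solve-∀
  eq : term u ((1 + 2 * b) * suc k + r) ≡ + 2 ℤ.* (1ℤ ℤ.+ + 2 ℤ.* z)
  eq = begin
    term u ((1 + 2 * b) * suc k + r)
      ≡⟨ cong (term u) index ⟩
    term u (b * (2 * suc k) + r′)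
      ≡⟨ q-eq r′ ⟩
    _
      ≡⟨ cong (λ y → y ℤ.+ + 4 ℤ.* 1ℤ ℤ.* + b ℤ.* term (middle u) r′
                       ℤ.+ + 8 ℤ.* 1ℤ ℤ.* term q r′)
           (trans (recurrence u r)
             (cong₂ (λ y z → + 2 ℤ.* y ℤ.- z) u-k+r≡odd u-r≡0)) ⟩
    _
      ≡⟨ identity (+ b) t (term (middle u) r′) (term q r′) ⟩
    _ ∎

-- With c = 2^e and u_r = 0 the expansion leaves 4 c (1 + 2 m) (1 + 2 t) + 8 c q, which is 2^(e+2)
-- times an odd number.
v₂-2^*odd-multiple : (u : Solution k) → ∀ r t e m →
  term u r ≡ 0ℤ → term (middle u) r ≡ 1ℤ ℤ.+ + 2 ℤ.* t →
  v₂ (term u ((1 + 2 * m) * 2 ^ suc e * suc k + r)) ≡ [ suc (suc e) ]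
v₂-2^*odd-multiple {k} u r t e m u-r≡0 middle-odd =
  trans (cong v₂ eq) (v₂-2^*odd (suc (suc e)) z)
  where
  open ≡-Reasoning
  expansion = expansion-* (+ (2 ^ e)) (1 + 2 * m) (expansion-2^ e) u
  q = proj₁ expansion
  a = (1 + 2 * m) * 2 ^ suc e
  c = + (2 ^ e)
  z = + m ℤ.+ t ℤ.+ + 2 ℤ.* + m ℤ.* t ℤ.+ term q r
  index : a * suc k + r ≡ (1 + 2 * m) * (2 ^ suc e * suc k) + r
  index = cong (_+ r) (ℕ.*-assoc (1 + 2 * m) (2 ^ suc e) (suc k))
  4c : + 2 ℤ.* (+ 2 ℤ.* c) ≡ + (2 ^ suc (suc e))
  4c = sym (trans (ℤ.pos-* 2 (2 ^ suc e))
    (cong (+ 2 ℤ.*_) (ℤ.pos-* 2 (2 ^ e))))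
  identity : ∀ c m t q →
    0ℤ ℤ.+ + 4 ℤ.* c ℤ.* (1ℤ ℤ.+ + 2 ℤ.* m) ℤ.* (1ℤ ℤ.+ + 2 ℤ.* t)
      ℤ.+ + 8 ℤ.* c ℤ.* q
    ≡ + 2 ℤ.* (+ 2 ℤ.* c) ℤ.* (1ℤ ℤ.+ + 2 ℤ.*
        (m ℤ.+ t ℤ.+ + 2 ℤ.* m ℤ.* t ℤ.+ q))
  identity = solve-∀
  eq : term u (a * suc k + r) ≡
    + (2 ^ suc (suc e)) ℤ.* (1ℤ ℤ.+ + 2 ℤ.* z)
  eq = begin
    term u (a * suc k + r)
      ≡⟨ cong (term u) index ⟩
    term u ((1 + 2 * m) * (2 ^ suc e * suc k) + r)
      ≡⟨ proj₂ expansion r ⟩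
    term u r ℤ.+ + 4 ℤ.* c ℤ.* + (1 + 2 * m) ℤ.* term (middle u) r
      ℤ.+ + 8 ℤ.* c ℤ.* term q r
      ≡⟨ cong₂ (λ y z → y ℤ.+ + 4 ℤ.* c ℤ.* z ℤ.* term (middle u) r
                          ℤ.+ + 8 ℤ.* c ℤ.* term q r) u-r≡0 (pos-odd m) ⟩
    0ℤ ℤ.+ + 4 ℤ.* c ℤ.* (1ℤ ℤ.+ + 2 ℤ.* + m) ℤ.* term (middle u) r
      ℤ.+ + 8 ℤ.* c ℤ.* term q r
      ≡⟨ cong (λ y → 0ℤ ℤ.+ + 4 ℤ.* c ℤ.* (1ℤ ℤ.+ + 2 ℤ.* + m) ℤ.* y
                        ℤ.+ + 8 ℤ.* c ℤ.* term q r) middle-odd ⟩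
    _
      ≡⟨ identity c (+ m) t (term q r) ⟩
    _
      ≡⟨ cong (ℤ._* (1ℤ ℤ.+ + 2 ℤ.* z)) 4c ⟩
    _ ∎

v₂-even-multiple : (u : Solution k) → ∀ r t a → Even (+ a) →
  term u r ≡ 0ℤ → term (middle u) r ≡ 1ℤ ℤ.+ + 2 ℤ.* t →
  v₂ (term u (a * suc k + r)) ≡ 1 +∞ v₂ (+ a)
-- For a = 0 both sides are `⊤⁺`.
v₂-even-multiple u r t zero even u-r≡0 _ = cong v₂ u-r≡0
v₂-even-multiple {k} u r t (suc a) even u-r≡0 middle-odd =
  let e , m , a-eq , v₂-a = v₂-even a even in
  trans (cong (λ l → v₂ (term u (l * suc k + r))) a-eq)
    (trans (v₂-2^*odd-multiple u r t e m u-r≡0 middle-odd)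
      (cong (1 +∞_) (sym v₂-a)))

-- The sequences B as solutions.

sum-applyUpTo-∷ʳ : ∀ f n →
  sum (applyUpTo f (suc n)) ≡ sum (applyUpTo f n) + f n
sum-applyUpTo-∷ʳ f zero    = ℕ.+-comm (f 0) 0
sum-applyUpTo-∷ʳ f (suc n) =
  trans (cong (λ y → f 0 + y) (sum-applyUpTo-∷ʳ (λ i → f (suc i)) n))
        (sym (ℕ.+-assoc (f 0) _ (f (suc n))))

sum-applyUpTo-zero : ∀ f n → (∀ i → i < n → f i ≡ 0) →
  sum (applyUpTo f n) ≡ 0
sum-applyUpTo-zero f zero    _  = refl
sum-applyUpTo-zero f (suc n) f≡0
  rewrite f≡0 0 (s≤s z≤n)
  = sum-applyUpTo-zero (λ i → f (suc i)) n λ i i<n → f≡0 (suc i) (s≤s i<n)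

sum-applyUpTo-single : ∀ f {n i} → i < n → (∀ l → l < n → l ≢ i → f l ≡ 0) →
  sum (applyUpTo f n) ≡ f i
sum-applyUpTo-single f {suc n} {zero} _ f≡0
  rewrite sum-applyUpTo-zero (λ i → f (suc i)) n
    (λ i i<n → f≡0 (suc i) (s≤s i<n) λ ())
  = ℕ.+-identityʳ (f 0)
sum-applyUpTo-single f {suc n} {suc i} (s≤s i<n) f≡0
  rewrite f≡0 0 (s≤s z≤n) (λ ())
  = sum-applyUpTo-single (λ l → f (suc l)) i<n
      λ l l<n l≢i → f≡0 (suc l) (s≤s l<n) λ { refl → l≢i refl }

-- B_k adds up all the initial values, exactly one of which is 1.
B-k : ∀ {k j} → j < k → B k j k ≡ 1
B-k {k} {j} j<k = begin
  B k j k
    ≡⟨ B-recurrence {k} {j} ℕ.≤-refl ⟩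
  sum (applyUpTo (λ i → B k j (k ∸ suc i)) k)
    -- The sum runs from B_(k-1) down to B_0, so B_j sits at position k - 1 - j.
    ≡⟨ sum-applyUpTo-single _ (ℕ.∸-monoʳ-< (s≤s z≤n) j<k) single ⟩
  B k j (k ∸ suc (k ∸ suc j))
    ≡⟨ cong (B k j) (reflect j<k) ⟩
  B k j j
    ≡⟨ B-initial-1 j<k ⟩
  1 ∎
  where
  open ≡-Reasoning
  reflect : ∀ {i} → i < k → k ∸ suc (k ∸ suc i) ≡ i
  reflect {i} i<k = begin
    k ∸ suc (k ∸ suc i) ≡⟨ cong (k ∸_) (sym (ℕ.+-∸-assoc 1 i<k)) ⟩
    k ∸ (k ∸ i)         ≡⟨ ℕ.m∸[m∸n]≡n (ℕ.<⇒≤ i<k) ⟩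
    i                   ∎
  single : ∀ i → i < k → i ≢ k ∸ suc j → B k j (k ∸ suc i) ≡ 0
  single i i<k i≢ = B-initial-0 (ℕ.∸-monoʳ-< (s≤s z≤n) i<k)
    λ eq → i≢ (trans (sym (reflect i<k)) (cong (λ l → k ∸ suc l) eq))

-- Both sides equal B_m + ... + B_(m+k): the lower k terms of this window again sum to B_(k+m).
B-telescope : ∀ k j m → B k j (suc (k + m)) + B k j m ≡ 2 * B k j (k + m)
B-telescope k j m = begin
  b (suc (k + m)) + b m
    ≡⟨ cong₂ _+_ (B-recurrence {k} {j} (ℕ.m≤n⇒m≤1+n (ℕ.m≤m+n k m)))
         (cong b (sym (ℕ.m+n∸m≡n k m))) ⟩
  sum (applyUpTo (λ i → b (k + m ∸ i)) k) + b (k + m ∸ k)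
    ≡⟨ sum-applyUpTo-∷ʳ (λ i → b (k + m ∸ i)) k ⟨
  b (k + m) + sum (applyUpTo (λ i → b (k + m ∸ suc i)) k)
    ≡⟨ cong (λ y → b (k + m) + y) (B-recurrence {k} {j} (ℕ.m≤m+n k m)) ⟨
  b (k + m) + b (k + m)
    ≡⟨ cong (λ y → b (k + m) + y) (ℕ.+-identityʳ (b (k + m))) ⟨
  2 * b (k + m) ∎
  where
  open ≡-Reasoning
  b = B k j

B-solution : ∀ k j → Solution k
term (B-solution k j) n = + B k j n
recurrence (B-solution k j) m = begin
  + b (suc (k + m))
    ≡⟨ identity (+ b (suc (k + m))) (+ b m) ⟩
  + (b (suc (k + m)) + b m) ℤ.- + b m
    ≡⟨ cong (λ y → + y ℤ.- + b m) (B-telescope k j m) ⟩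
  + (2 * b (k + m)) ℤ.- + b m
    ≡⟨ cong (ℤ._- + b m) (ℤ.pos-* 2 (b (k + m))) ⟩
  + 2 ℤ.* + b (k + m) ℤ.- + b m ∎
  where
  open ≡-Reasoning
  b = B k j
  identity : ∀ x y → x ≡ x ℤ.+ y ℤ.- y
  identity = solve-∀

recurrence-suc : (u : Solution k) → ∀ m →
  term u (k + suc m) ≡ + 2 ℤ.* term u (k + m) ℤ.- term u m
recurrence-suc {k} u m = trans (cong (term u) (ℕ.+-suc k m)) (recurrence u m)

-- If a were negative, r = n - a (k + 1) would be at least k + 1, beyond its upper bound.
quotient-nonNegative : ∀ {k n a r} →
  + n ≡ a ℤ.* + (k + 1) ℤ.+ r → r ℤ.≤ + (k ∸ 1) → ∃[ m ] a ≡ + m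
quotient-nonNegative {a = + m} _ _ = m , refl
quotient-nonNegative {k} {n} {ℤ.-[1+ m ]} {r} eq r≤k∸1 =
  contradiction (ℤ.drop‿+≤+ (subst (ℤ._≤ + (k ∸ 1)) r-eq r≤k∸1))
    (ℕ.<⇒≱ (begin-strict
    k ∸ 1                 ≤⟨ ℕ.m∸n≤m k 1 ⟩
    k                     <⟨ ℕ.m<m+n k (s≤s z≤n) ⟩
    k + 1                 ≤⟨ ℕ.m≤m+n (k + 1) (m * (k + 1)) ⟩
    suc m * (k + 1)       ≤⟨ ℕ.m≤n+m _ n ⟩
    n + suc m * (k + 1)   ∎))
  where
  open ℕ.≤-Reasoning
  identity : ∀ x y r → r ≡ ℤ.- x ℤ.* y ℤ.+ r ℤ.+ x ℤ.* y
  identity = solve-∀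
  r-eq : r ≡ + (n + suc m * (k + 1))
  r-eq = trans (identity (+ suc m) (+ (k + 1)) r)
    (cong₂ ℤ._+_ (sym eq) (sym (ℤ.pos-* (suc m) (k + 1))))

-- The residues 0, 1 and j + 1 for order K = k + 2.

module _ {k j : ℕ} (j<k : j < suc (suc k)) where

  private
    K = suc (suc k)
    U = B-solution K j
    b = term U

  b-j : b j ≡ 1ℤ
  b-j = cong +_ (B-initial-1 j<k)

  b-≢j : ∀ {i} → i < K → i ≢ j → b i ≡ 0ℤ
  b-≢j i<K i≢j = cong +_ (B-initial-0 i<K i≢j)

  b-K : b (K + 0) ≡ 1ℤ
  b-K = trans (cong b (ℕ.+-identityʳ K)) (cong +_ (B-k j<k))

  valuation-0-odd : ∀ a → j ≥ 1 → Odd (+ a) →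
    v₂ (b (a * suc K + 0)) ≡ [ 1 ]
  valuation-0-odd a j≥1 odd =
    v₂-odd-multiple U 0 0ℤ a odd (b-≢j (s≤s z≤n) (ℕ.<⇒≢ j≥1)) b-K

  -- Since j differs from K - 1, B_(K-1) = 0 and B_2K = 2 B_(2K-1) - B_(K-1) is even, while B_K = 1.
  valuation-0-even : ∀ a → j ≥ 1 → j ≤ k → Even (+ a) →
    v₂ (b (a * suc K + 0)) ≡ 1 +∞ v₂ (+ a)
  valuation-0-even a j≥1 j≤k even =
    v₂-even-multiple U 0 (b (K + (suc k + 0))) a even
      (b-≢j (s≤s z≤n) (ℕ.<⇒≢ j≥1))
      (trans (cong₂ ℤ._+_ b-K (trans (recurrence-suc U (suc k + 0))
               (cong (λ y → + 2 ℤ.* b (K + (suc k + 0)) ℤ.- y) b-k+1)))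
             (identity (b (K + (suc k + 0)))))
    where
    b-k+1 : b (suc k + 0) ≡ 0ℤ
    b-k+1 = trans (cong b (ℕ.+-identityʳ (suc k)))
      (b-≢j (ℕ.n<1+n (suc k)) (≢-sym (ℕ.<⇒≢ (s≤s j≤k))))
    identity : ∀ x → 1ℤ ℤ.+ (+ 2 ℤ.* x ℤ.- 0ℤ) ≡ 1ℤ ℤ.+ + 2 ℤ.* x
    identity = solve-∀

  valuation-1-odd-j≡0 : ∀ a → j ≡ 0 → Odd (+ a) →
    v₂ (b (a * suc K + 1)) ≡ [ 1 ]
  valuation-1-odd-j≡0 a refl odd =
    v₂-odd-multiple U 1 0ℤ a odd (b-≢j (s≤s (s≤s z≤n)) λ ())
      (trans (recurrence-suc U 0) (cong₂ (λ y z → + 2 ℤ.* y ℤ.- z) b-K b-j))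

  -- B_(K+1) = 2 B_K - B_0 = 2 is even, and B_(2K+1) = 2 B_2K - B_K is odd.
  valuation-1-even : ∀ a → j ≥ 2 → Even (+ a) →
    v₂ (b (a * suc K + 1)) ≡ 1 +∞ v₂ (+ a)
  valuation-1-even a j≥2 even =
    v₂-even-multiple U 1 (b (K + (suc k + 1))) a even
      (b-≢j (s≤s (s≤s z≤n)) (ℕ.<⇒≢ j≥2))
      (trans (cong₂ ℤ._+_
        (trans (recurrence-suc U 0)
          (cong₂ (λ y z → + 2 ℤ.* y ℤ.- z) b-K b-0))
        (trans (recurrence-suc U (suc k + 1))
          (cong (λ y → + 2 ℤ.* b (K + (suc k + 1)) ℤ.- y)
            (trans (cong (λ i → b (suc i)) (ℕ.+-suc k 0)) b-K))))
        (identity (b (K + (suc k + 1)))))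
    where
    b-0 : b 0 ≡ 0ℤ
    b-0 = b-≢j (s≤s z≤n) (ℕ.<⇒≢ (ℕ.<⇒≤ j≥2))
    identity : ∀ x →
      + 2 ℤ.* 1ℤ ℤ.- 0ℤ ℤ.+ (+ 2 ℤ.* x ℤ.- 1ℤ) ≡ 1ℤ ℤ.+ + 2 ℤ.* x
    identity = solve-∀

  -- B is continued backwards by k places, as
  -- a (k + 1) + 1 = (a + 1) (k + 1) - k and a + 1 is even.
  valuation-1-odd : ∀ a → j ≥ 2 → Odd (+ a) →
    v₂ (b (a * suc K + 1)) ≡ 1 +∞ v₂ (+ suc a)
  valuation-1-odd a j≥2 odd
    with m , refl ← odd-ℕ {a} odd
    with v , v≡b ← unshift K U
    = trans (cong v₂ (trans (sym (v≡b (a * suc K + 1))) (cong (term v) index)))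
        -- Here v_0 = 2 v_K - v_(K+1) = 2 B_0 - B_1 = 0, and v_K + v_2K = B_0 + B_K = 1.
        (v₂-even-multiple v 0 0ℤ (suc a) even
          (v-0 v v≡b)
          (cong₂ ℤ._+_ (trans (v≡b 0) b-0) (trans (v≡b (K + 0)) b-K)))
    where
    open ≡-Reasoning
    b-0 : b 0 ≡ 0ℤ
    b-0 = b-≢j (s≤s z≤n) (ℕ.<⇒≢ (ℕ.<⇒≤ j≥2))
    even : Even (+ suc a)
    even = subst (2 ℕ.∣_) (cong suc (ℕ.+-suc m (m + 0))) (ℕ.m∣m*n (suc m))
    index : K + (a * suc K + 1) ≡ suc a * suc K + 0
    index = begin
      K + (a * suc K + 1)  ≡⟨ cong (λ l → K + l) (ℕ.+-comm (a * suc K) 1) ⟩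
      K + suc (a * suc K)  ≡⟨ ℕ.+-suc K (a * suc K) ⟩
      suc a * suc K        ≡⟨ ℕ.+-identityʳ (suc a * suc K) ⟨
      suc a * suc K + 0    ∎
    identity : ∀ x y → x ≡ + 2 ℤ.* y ℤ.- (+ 2 ℤ.* y ℤ.- x)
    identity = solve-∀
    v-0 : (v : Solution K) → (∀ m → term v (K + m) ≡ b m) → term v 0 ≡ 0ℤ
    v-0 v v≡b = begin
      term v 0
        ≡⟨ identity (term v 0) (term v (K + 0)) ⟩
      + 2 ℤ.* term v (K + 0) ℤ.- (+ 2 ℤ.* term v (K + 0) ℤ.- term v 0)
        ≡⟨ cong (λ y → + 2 ℤ.* term v (K + 0) ℤ.- y) (recurrence-suc v 0) ⟨
      + 2 ℤ.* term v (K + 0) ℤ.- term v (K + 1)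
        ≡⟨ cong₂ (λ y z → + 2 ℤ.* y ℤ.- z) (trans (v≡b 0) b-0)
             (trans (v≡b 1) (b-≢j (s≤s (s≤s z≤n)) (ℕ.<⇒≢ j≥2))) ⟩
      0ℤ ∎

  -- B_(K+j+1) = 2 B_(K+j) - B_j is odd, which settles odd a. For even a, B_(j-1) = 0 makes B_(K+j)
  -- even, hence also B_(2K+j+1) = 2 B_(2K+j) - B_(K+j).
  valuation-j+1 : ∀ a → suc j < K → j ≥ 1 →
    v₂ (b (a * suc K + suc j)) ≡ 1 +∞ v₂ (+ a)
  -- The match on j ≥ 1 provides `i` = j - 1.
  valuation-j+1 a j+1<K (s≤s {n = i} _) with 2 ℕ.∣? a
  ... | no odd = trans
    (v₂-odd-multiple U (suc j) (b (K + j) ℤ.- 1ℤ) a odd b-j+1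
      (trans b-K+j+1 (identity (b (K + j)))))
    (cong (1 +∞_) (sym (v₂-complete (+ a) {0} (ℕ.1∣ a) odd)))
    where
    b-j+1 : b (suc j) ≡ 0ℤ
    b-j+1 = b-≢j j+1<K ℕ.1+n≢n
    b-K+j+1 : b (K + suc j) ≡ + 2 ℤ.* b (K + j) ℤ.- 1ℤ
    b-K+j+1 = trans (recurrence-suc U j)
      (cong (λ y → + 2 ℤ.* b (K + j) ℤ.- y) b-j)
    identity : ∀ x → + 2 ℤ.* x ℤ.- 1ℤ ≡ 1ℤ ℤ.+ + 2 ℤ.* (x ℤ.- 1ℤ)
    identity = solve-∀
  ... | yes even = v₂-even-multiple U (suc j)
    (b (K + i) ℤ.+ b (K + (K + j)) ℤ.- 1ℤ) a even (b-≢j j+1<K ℕ.1+n≢n)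
    (begin
      b (K + suc j) ℤ.+ b (K + (K + suc j))
        ≡⟨ cong₂ ℤ._+_ (recurrence-suc U j)
             (trans (cong (λ i → b (K + i)) (ℕ.+-suc K j))
                    (recurrence-suc U (K + j))) ⟩
      + 2 ℤ.* b (K + j) ℤ.- b j ℤ.+ (+ 2 ℤ.* b (K + (K + j)) ℤ.- b (K + j))
        ≡⟨ cong₂ (λ y z → + 2 ℤ.* y ℤ.- z
                    ℤ.+ (+ 2 ℤ.* b (K + (K + j)) ℤ.- y))
             (trans (recurrence-suc U i)
               (cong (λ y → + 2 ℤ.* b (K + i) ℤ.- y)
                 (b-≢j (ℕ.<-trans (ℕ.n<1+n i) j<k) (ℕ.<⇒≢ (ℕ.n<1+n i)))))
             b-j ⟩
      _
        ≡⟨ identity (b (K + i)) (b (K + (K + j))) ⟩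
      _ ∎)
    where
    open ≡-Reasoning
    identity : ∀ y z →
      + 2 ℤ.* (+ 2 ℤ.* y ℤ.- 0ℤ) ℤ.- 1ℤ ℤ.+ (+ 2 ℤ.* z ℤ.- (+ 2 ℤ.* y ℤ.- 0ℤ))
      ≡ 1ℤ ℤ.+ + 2 ℤ.* (y ℤ.+ z ℤ.- 1ℤ)
    identity = solve-∀

theorem7 : ∀ (k j n : ℕ) (a r : ℤ) →
    2 ≤ k →
    j ≤ k ∸ 1 →
    + n ≡ a ℤ.* + (k + 1) ℤ.+ r →
    -1ℤ ℤ.≤ r →
    r ℤ.≤ + (k ∸ 1) →
    (r ≡ 0ℤ → j ≥ 1 → Odd a →
    v₂ (+ B k j n) ≡ [ 1 ])
    ×
    (r ≡ 0ℤ → 1 ≤ j → j ≤ k ∸ 2 → Even a → v₂ a ≤⁺ [ k ] →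
    v₂ (+ B k j n) ≡ 1 +∞ v₂ a)
    ×
    (r ≡ 1ℤ → j ≥ 2 → Odd a → v₂ (a ℤ.+ 1ℤ) ≤⁺ [ k + 1 ] →
    v₂ (+ B k j n) ≡ 1 +∞ v₂ (a ℤ.+ 1ℤ))
    ×
    (r ≡ 1ℤ → j ≥ 2 → Even a → v₂ a ≤⁺ [ k + 1 ] →
    v₂ (+ B k j n) ≡ 1 +∞ v₂ a)
    ×
    (r ≡ 1ℤ → j ≡ 0 → Odd a →
    v₂ (+ B k j n) ≡ [ 1 ])
    ×
    (r ≡ + (j + 1) → j + 1 ≤ k ∸ 1 → j ≥ 1 → v₂ a ≤⁺ [ k ] →
    v₂ (+ B k j n) ≡ 1 +∞ v₂ a)
theorem7 k@(suc (suc k′)) j n a r (s≤s (s≤s z≤n)) j≤k∸1 n-eq _ r≤k∸1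
  with a′ , refl ← quotient-nonNegative {k} {n} {a} {r} n-eq r≤k∸1
  = (λ { refl j≥1 odd →
         trans (at a′ 0 n-eq) (valuation-0-odd j<k a′ j≥1 odd) })
  , (λ { refl j≥1 j≤k∸2 even _ →
         trans (at a′ 0 n-eq) (valuation-0-even j<k a′ j≥1 j≤k∸2 even) })
  , (λ { refl j≥2 odd _ →
         trans (at a′ 1 n-eq) (trans (valuation-1-odd j<k a′ j≥2 odd)
           (cong (λ x → 1 +∞ v₂ (+ x)) (ℕ.+-comm 1 a′))) })
  , (λ { refl j≥2 even _ →
         trans (at a′ 1 n-eq) (valuation-1-even j<k a′ j≥2 even) })
  , (λ { refl j≡0 odd →
         trans (at a′ 1 n-eq) (valuation-1-odd-j≡0 j<k a′ j≡0 odd) })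
  , (λ { refl j+1≤k∸1 j≥1 _ →
         trans (at a′ (j + 1) n-eq)
           (trans (cong (λ i → v₂ (+ B k j (a′ * suc k + i))) (ℕ.+-comm j 1))
             (valuation-j+1 j<k a′
               (s≤s (subst (_≤ suc k′) (ℕ.+-comm j 1) j+1≤k∸1)) j≥1)) })
  where
  j<k : j < k
  j<k = s≤s j≤k∸1
  at : ∀ a′ i → + n ≡ + a′ ℤ.* + (k + 1) ℤ.+ + i →
    v₂ (+ B k j n) ≡ v₂ (+ B k j (a′ * suc k + i))
  at a′ i eq = cong (λ l → v₂ (+ B k j l)) (trans
    (ℤ.+-injective (trans eq (cong (ℤ._+ + i) (sym (ℤ.pos-* a′ (k + 1))))))
    (cong (λ l → a′ * l + i) (ℕ.+-comm k 1)))
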